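{- For any Boolean assignment tuple $(\sigma_1,\ldots,\sigma_n)\in\{0,1\}^n$, the relation $G[\sigma_1,\ldots,\sigma_n]$ is an equivalence relation over the satisfiable Boolean functions of $n$ variables represented in conjunctive normal form with $m$ clauses.
   Context: The relation. For Boolean functions $f,h$ of $n$ variables, both in conjunctive normal form with $m$ clauses, $(f,h)\in G[\sigma_1,\ldots,\sigma_n]$ if $f(\sigma_1,\ldots,\sigma_n)=1$ and $h$ is generated by $f$ as a result of admissible changes under the satisfying assignment $(\sigma_1,\ldots,\sigma_n)$. The notions used are as follows. CNF conventions. A Boolean function $f(x_1,\ldots,x_n)$ in conjunctive normal form (CNF) with $m$ clauses is given as $f=\bigwedge_{i=1}^m c_i$, each clause being $c_i=x_{j_1}^{\alpha_1}\vee\cdots\vee x_{j_k}^{\alpha_k}$ with $k\in\{1,\ldots,n\}$, $\{j_1,\ldots,j_k\}\subseteq\{1,\ldots,n\}$, $\alpha_r\in\{0,1\}$, $x_j^0=\bar x_j$, $x_j^1=x_j$. Standing assumptions: no clause contains both a variable and its negation; every variable $x_j$, $j\in\{1,\ldots,n\}$, occurs (negated or not) in some clause. Clauses are numbered and identified with their numbers, so $S(f)=\{c_1,\ldots,c_m\}$ is an ordered set of $m$ elements. $f$ is satisfiable if $f(\sigma)=1$ for some $\sigma\in\{0,1\}^n$. Special decomposition and covering. For a nonempty ordered set $S=\{e_1,\ldots,e_m\}$, an ordered set $d_nS=\{(M_1^0,M_1^1),\ldots,(M_n^0,M_n^1)\}$ of ordered pairs of subsets of $S$ is a special decomposition of $S$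 if for all $i$, $M_i^0\cap M_i^1=\emptyset$ and ($M_i^0\ne\emptyset$ or $M_i^1\neq\emptyset$), and $\bigcup_{i}(M_i^0\cup M_i^1)=S$. The ordered set $c_nS=\{M_1^{\alpha_1},\ldots,M_n^{\alpha_n}\}$ is a special covering for $S$ under $d_nS$ if $\bigcup_i M_i^{\alpha_i}=S$. Decomposition generated by $f$. $d_nS(f)=\{(F_1^0,F_1^1),\ldots,(F_n^0,F_n^1)\}$, where $F_i^\alpha$ is the set of clauses $c_j\in S(f)$ containing the literal $x_i^\alpha$. When $f(\sigma_1,\ldots,\sigma_n)=1$, $\{F_1^{\sigma_1},\ldots,F_n^{\sigma_n}\}$ is the associated special covering $c_nS(f)$. Function generated by a special decomposition $d_nS$. $h=\bigwedge_{i=1}^m c_i'$, where $c_i'$ is the disjunction of the literals in $\{x_j^\alpha: e_i\in M_j^\alpha,\ j\in\{1,\ldots,n\},\ \alpha\in\{0,1\}\}$. Admissible changes under a tuple $(\alpha_1,\ldots,\alpha_n)$. Let $c_nS=\{M_1^{\alpha_1},\ldots,M_n^{\alpha_n}\}$ be a special covering under $d_nS$. Write $\bar\delta=1-\delta$; membership of $M_i^\delta$ in $c_nS$ means $\delta=\alpha_i$. The following changes are admissible: (i.1) for $e\in M_i^\delta$, replace $M_i^\delta$ by $M_i^\delta\setminus\{e\}$, if $M_i^\delta\notin c_nS$ and $(M_i^\delta\setminus\{e\})\cup M_i^{\bar\delta}\neq\emptyset$; (i.2) for $e\in S$ with $e\notin M_i^0\cup M_i^1$, replace $M_i^\delta$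 by $M_i^\delta\cup\{e\}$; (i.3) if $M_j^\gamma$ and $M_i^\delta$ are both in $c_nS$, then for $e$ with $e\in M_j^\gamma$ and $e\notin M_i^{\bar\delta}$, replace $M_j^\gamma$ by $M_j^\gamma\setminus\{e\}$ and $M_i^\delta$ by $M_i^\delta\cup\{e\}$. An ordered set of pairs is generated by $d_nS$ as a result of admissible changes under $(\alpha_1,\ldots,\alpha_n)$ if it is obtained from $d_nS$ by such changes, applied successively, each to the current pairs and with the current covering sets having the same subscripts and superscripts. Generation of functions. $h$ is generated by $f$ as a result of admissible changes under $(\sigma_1,\ldots,\sigma_n)$ if $f(\sigma_1,\ldots,\sigma_n)=1$, $f$ generates the special decomposition $d_nS(f)$, a special decomposition $d_nS(f)G$ is generated by $d_nS(f)$ as a result of admissible changes under $(\sigma_1,\ldots,\sigma_n)$, and $h$ is the function generated by $d_nS(f)G$.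
   Formalization: Reflexivity holds only for functions with f(σ)=1 (x_1 with σ=0 is satisfiable but unrelated to itself); symmetry and transitivity are proved on all satisfiable functions. Every intermediate family of pairs must be a special decomposition, as symmetry otherwise fails for m=1. -}

module Defs where

open import Data.Bool using (Bool; true; false; not; if_then_else_)
import Data.Bool.Properties as Bool
open import Data.Bool.ListAction using (any; all)
open import Data.Fin using (Fin)
import Data.Fin.Properties as Fin
open import Data.Fin.Subset using (Subset; _∈_; _∉_; _∪_; _∩_; _-_; ⁅_⁆; Nonempty; Empty)
open import Data.List using (List; length)
import Data.List.Membership.Propositional as List
import Data.List.Membership.DecPropositional as DecMembership
open import Data.List.Relation.Unary.Unique.Propositional using (Unique)
open import Data.Nat using (ℕ; _≤_)
open import Data.Product using (∃-syntax; ∃₂; _×_; _,_; proj₁; proj₂; map₁; map₂)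
open import Data.Product.Properties using (≡-dec)
open import Data.Sum using (_⊎_)
open import Data.Vec using (Vec; lookup; tabulate; toList; updateAt)
open import Function using (const; _⇔_)
open import Relation.Binary.Construct.Closure.ReflexiveTransitive using (Star)
open import Relation.Binary.Definitions using (DecidableEquality)
open import Relation.Binary.PropositionalEquality using (_≡_)
open import Relation.Nullary using (¬_; does)

private
  variable
    n m : ℕ

-- Exponents and truth values are Booleans: 0 is false, 1 is true.

Assignment : ℕ → Set
Assignment n = Vec Bool n

-- (j , α) stands for the literal x_j^α, so (j , false) is the negation of x_j.
Literal : ℕ → Set
Literal n = Fin n × Bool

_≟ᴸ_ : DecidableEquality (Literal n)
_≟ᴸ_ = ≡-dec Fin._≟_ Bool._≟_

Clause : ℕ → Set
Clause n = List (Literal n)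

-- Clauses are identified with their numbers, so S(f) is Fin m. The fields
-- distinct and consistent together say that x_{j_1}, …, x_{j_k} are distinct
-- variables (hence k ≤ n).
record CNF (n m : ℕ) : Set where
  field
    clauses    : Vec (Clause n) m
    nonempty   : ∀ c → 1 ≤ length (lookup clauses c)
    distinct   : ∀ c → Unique (lookup clauses c)
    consistent : ∀ c j → ¬ ((j , false) List.∈ lookup clauses c ×
                            (j , true)  List.∈ lookup clauses c)
    occurs     : ∀ j → ∃₂ λ c α → (j , α) List.∈ lookup clauses c

open CNF public

evalLiteral : Assignment n → Literal n → Bool
evalLiteral σ (j , α) = if α then lookup σ j else not (lookup σ j)

evalClause : Assignment n → Clause n → Bool
evalClause σ c = any (evalLiteral σ) c

eval : CNF n m → Assignment n → Bool
eval f σ = all (evalClause σ) (toList (clauses f))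

Satisfiable : CNF n m → Set
Satisfiable f = ∃[ σ ] eval f σ ≡ true

-- Ordered families (M_1^0 , M_1^1), …, (M_n^0 , M_n^1) of pairs of subsets of
-- the ordered set S = Fin m.
Family : ℕ → ℕ → Set
Family n m = Vec (Subset m × Subset m) n

-- D ⟨ i , δ ⟩ is M_i^δ.
infix 8 _⟨_,_⟩
_⟨_,_⟩ : Family n m → Fin n → Bool → Subset m
D ⟨ i , false ⟩ = proj₁ (lookup D i)
D ⟨ i , true  ⟩ = proj₂ (lookup D i)

infixl 6 _⟨_,_⟩≔_
_⟨_,_⟩≔_ : Family n m → Fin n → Bool → Subset m → Family n m
D ⟨ i , false ⟩≔ M = updateAt D i (map₁ (const M))
D ⟨ i , true  ⟩≔ M = updateAt D i (map₂ (const M))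

record IsSpecialDecomposition (D : Family n m) : Set where
  field
    disjoint  : ∀ i → Empty (D ⟨ i , false ⟩ ∩ D ⟨ i , true ⟩)
    inhabited : ∀ i → Nonempty (D ⟨ i , false ⟩) ⊎ Nonempty (D ⟨ i , true ⟩)
    covers    : ∀ e → ∃[ i ] e ∈ D ⟨ i , false ⟩ ∪ D ⟨ i , true ⟩

IsSpecialCovering : Assignment n → Family n m → Set
IsSpecialCovering α D = ∀ e → ∃[ i ] e ∈ D ⟨ i , lookup α i ⟩

-- The position of M_i^δ belongs to the covering { M_1^{α_1}, …, M_n^{α_n} };
-- membership is by subscript and superscript, not by equality of sets.
InCovering : Assignment n → Fin n → Bool → Set
InCovering α i δ = δ ≡ lookup α i

remove : Fin n → Bool → Fin m → Family n m → Family n m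
remove i δ e D = D ⟨ i , δ ⟩≔ (D ⟨ i , δ ⟩ - e)

insert : Fin n → Bool → Fin m → Family n m → Family n m
insert i δ e D = D ⟨ i , δ ⟩≔ (D ⟨ i , δ ⟩ ∪ ⁅ e ⁆)

-- In `move` the removal is performed before the insertion, so that for
-- (j , γ) = (i , δ) the change leaves D as it is.
data Change (α : Assignment n) (D : Family n m) : Family n m → Set where
  delete : ∀ {i δ e} →
           e ∈ D ⟨ i , δ ⟩ →
           ¬ InCovering α i δ →
           Nonempty ((D ⟨ i , δ ⟩ - e) ∪ D ⟨ i , not δ ⟩) →
           Change α D (remove i δ e D)
  add    : ∀ {i δ e} →
           e ∉ D ⟨ i , false ⟩ ∪ D ⟨ i , true ⟩ →
           Change α D (insert i δ e D)
  move   : ∀ {j γ i δ e} →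
           InCovering α j γ →
           InCovering α i δ →
           e ∈ D ⟨ j , γ ⟩ →
           e ∉ D ⟨ i , not δ ⟩ →
           Change α D (insert i δ e (remove j γ e D))

-- Changes are defined only for a special decomposition with a special
-- covering, so each successive change requires the current family to be one.
record AdmissibleChange (α : Assignment n) (D D′ : Family n m) : Set where
  field
    decomposition : IsSpecialDecomposition D
    covering      : IsSpecialCovering α D
    change        : Change α D D′

-- The empty sequence of changes is allowed.
GeneratedUnder : Assignment n → Family n m → Family n m → Set
GeneratedUnder α = Star (AdmissibleChange α)

-- The family (F_1^0 , F_1^1), …, (F_n^0 , F_n^1), where F_i^α is the set of
-- clauses of f containing x_i^α.
occurrences : CNF n m → Fin n → Bool → Subset m
occurrences f i α = tabulate λ c → does ((i , α) ∈? lookup (clauses f) c)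
  where open DecMembership _≟ᴸ_ using (_∈?_)

decompositionOf : CNF n m → Family n m
decompositionOf f = tabulate λ i → occurrences f i false , occurrences f i true

-- h is the function generated by D: its clause number e is the disjunction of
-- the set of literals { x_j^α : e ∈ M_j^α }, in any order.
FunctionGeneratedBy : Family n m → CNF n m → Set
FunctionGeneratedBy D h =
  ∀ e j α → (j , α) List.∈ lookup (clauses h) e ⇔ e ∈ D ⟨ j , α ⟩

record G (σ : Assignment n) (f h : CNF n m) : Set where
  field
    satisfied     : eval f σ ≡ true
    family        : Family n m
    source        : IsSpecialDecomposition (decompositionOf f)
    generated     : GeneratedUnder σ (decompositionOf f) family
    target        : IsSpecialDecomposition family
    generatesFunc : FunctionGeneratedBy family h

SatisfiableCNF : ℕ → ℕ → Set
SatisfiableCNF n m = ∃[ f ] Satisfiable {n} {m} f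

-- G σ f h demands f(σ) = 1, so a satisfiable f with f(σ) = 0 is not related to
-- itself; reflexivity is available exactly on this domain.
CNFSatisfiedBy : ∀ {n} → Assignment n → ℕ → Set
CNFSatisfiedBy {n} σ m = ∃[ f ] eval {n} {m} f σ ≡ true

{-# OPTIONS --safe #-}

-- Each admissible change between special decompositions can be undone by
-- admissible changes, and changes preserve the covering. Hence generation is
-- symmetric between special decompositions. Since h and its clause sets
-- determine each other, the family reached from d_nS(f) in G σ f h is d_nS(h),
-- so symmetry and transitivity pass from families to functions.

module Submission where

open import Defs
open import Data.Bool using (Bool; true; false; not; T)
open import Data.Bool.Properties using (not-¬; T-≡)
import Data.Bool.Properties as Bool
open import Data.Fin using (Fin; zero; suc)
import Data.Fin.Properties as Fin
open import Data.Fin.Subset using (Subset; _∈_; _∉_; _∪_; _-_; Nonempty)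
open import Data.Fin.Subset.Properties using (_∈?_; ⊆-antisym; p─q⊆p; x∈p∧x≢y⇒x∈p-y;
  x∈⁅x⁆; x∈⁅y⁆⇒x≡y; x∈p∩q⁺; x∈p∩q⁻; x∈p∪q⁺; x∈p∪q⁻)
open import Data.List using (length; _∷_)
import Data.List.Membership.Propositional as List
import Data.List.Membership.DecPropositional as DecMembership
open import Data.List.Relation.Unary.All.Properties using (all⁺; all⁻)
open import Data.List.Relation.Unary.Any using (here)
open import Data.List.Relation.Unary.Any.Properties using (any⁺; any⁻)
open import Data.Nat using (ℕ; NonZero; _≤_)
open import Data.Product using (∃-syntax; ∃₂; _×_; _,_; proj₁; proj₂; map₂)
open import Data.Product.Properties using (≡-dec)
open import Data.Sum using (_⊎_; inj₁; inj₂; [_,_]′)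
open import Data.Vec using (_∷_; there; lookup; tabulate)
import Data.Vec.Relation.Unary.All.Properties as VecAll
open import Data.Vec.Properties using (lookup∘updateAt; lookup∘updateAt′; lookup∘tabulate;
  tabulate∘lookup; tabulate-cong; []=⇒lookup; lookup⇒[]=)
open import Function using (_∘_; id; _⇔_; mk⇔; Equivalence)
open import Relation.Binary.Construct.Closure.ReflexiveTransitive using (ε; _◅_; _◅◅_)
open import Relation.Binary.Definitions using (DecidableEquality)
open import Relation.Binary.PropositionalEquality
  using (_≡_; _≢_; refl; sym; trans; cong; cong₂; subst; ≢-sym; module ≡-Reasoning)
open import Relation.Binary.Structures using (IsEquivalence; IsPartialEquivalence)
open import Relation.Nullary using (¬_; Dec; does; yes; no; contradiction)
open import Relation.Nullary.Decidable using (dec-true)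

private
  variable
    n m : ℕ

does-true⁻ : {A : Set} (a? : Dec A) → does a? ≡ true → A
does-true⁻ (yes a) _ = a

-- Families as sets of positions: the triple `(i , δ , e)` stands for e in M_i^δ.

Position : ℕ → ℕ → Set
Position n m = Fin n × Bool × Fin m

_≟ᴾ_ : DecidableEquality (Position n m)
_≟ᴾ_ = ≡-dec Fin._≟_ (≡-dec Bool._≟_ Fin._≟_)

-- A record, so that D and p can be inferred: _⟨_,_⟩ is not injective.
infix 4 _∋_
record _∋_ (D : Family n m) (p : Position n m) : Set where
  constructor mem
  field
    unmem : proj₂ (proj₂ p) ∈ D ⟨ proj₁ p , proj₁ (proj₂ p) ⟩

open _∋_

insertAt removeAt : Position n m → Family n m → Family n m
insertAt (i , δ , e) = insert i δ e
removeAt (i , δ , e) = remove i δ e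

x∉p-x : (x : Fin n) (p : Subset n) → x ∉ p - x
x∉p-x zero    (true  ∷ _) ()
x∉p-x zero    (false ∷ _) ()
x∉p-x (suc x) (_ ∷ p)     (there x∈) = x∉p-x x p x∈

⟨⟩≔-updates : (D : Family n m) (i : Fin n) (δ : Bool) (M : Subset m) →
              (D ⟨ i , δ ⟩≔ M) ⟨ i , δ ⟩ ≡ M
⟨⟩≔-updates D i false M = cong proj₁ (lookup∘updateAt i D)
⟨⟩≔-updates D i true  M = cong proj₂ (lookup∘updateAt i D)

⟨⟩≔-minimal : (D : Family n m) {i k : Fin n} {δ γ : Bool} (M : Subset m) →
              (k , γ) ≢ (i , δ) → (D ⟨ i , δ ⟩≔ M) ⟨ k , γ ⟩ ≡ D ⟨ k , γ ⟩
⟨⟩≔-minimal D {i} {k} M ≢ with k Fin.≟ i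
⟨⟩≔-minimal D {δ = false} {false} M ≢ | yes refl = contradiction refl ≢
⟨⟩≔-minimal D {δ = true}  {true}  M ≢ | yes refl = contradiction refl ≢
⟨⟩≔-minimal D {δ = false} {true}  M ≢ | yes refl = cong proj₂ (lookup∘updateAt _ D)
⟨⟩≔-minimal D {δ = true}  {false} M ≢ | yes refl = cong proj₁ (lookup∘updateAt _ D)
⟨⟩≔-minimal D {δ = false} {false} M ≢ | no k≢i = cong proj₁ (lookup∘updateAt′ _ _ k≢i D)
⟨⟩≔-minimal D {δ = false} {true}  M ≢ | no k≢i = cong proj₂ (lookup∘updateAt′ _ _ k≢i D)
⟨⟩≔-minimal D {δ = true}  {false} M ≢ | no k≢i = cong proj₁ (lookup∘updateAt′ _ _ k≢i D)
⟨⟩≔-minimal D {δ = true}  {true}  M ≢ | no k≢i = cong proj₂ (lookup∘updateAt′ _ _ k≢i D)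

module _ (D : Family n m) (p : Position n m) where
  private
    i = proj₁ p
    δ = proj₁ (proj₂ p)
    e = proj₂ (proj₂ p)

  ∋-insert : insertAt p D ∋ p
  ∋-insert .unmem = subst (e ∈_) (sym (⟨⟩≔-updates D i δ _)) (x∈p∪q⁺ (inj₂ (x∈⁅x⁆ e)))

  ∋-insert⁺ : ∀ {q} → D ∋ q → insertAt p D ∋ q
  ∋-insert⁺ {k , γ , e′} (mem q∈) .unmem with (k , γ) ≟ᴸ (i , δ)
  ... | yes refl = subst (e′ ∈_) (sym (⟨⟩≔-updates D i δ _)) (x∈p∪q⁺ (inj₁ q∈))
  ... | no  ≢    = subst (e′ ∈_) (sym (⟨⟩≔-minimal D _ ≢)) q∈

  ∋-insert⁻ : ∀ {q} → insertAt p D ∋ q → D ∋ q ⊎ q ≡ p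
  ∋-insert⁻ {k , γ , e′} (mem q∈) with (k , γ) ≟ᴸ (i , δ)
  ... | no  ≢    = inj₁ (mem (subst (e′ ∈_) (⟨⟩≔-minimal D _ ≢) q∈))
  ... | yes refl with x∈p∪q⁻ _ _ (subst (e′ ∈_) (⟨⟩≔-updates D i δ _) q∈)
  ...   | inj₁ e′∈ = inj₁ (mem e′∈)
  ...   | inj₂ e′∈ = inj₂ (cong (λ x → i , δ , x) (x∈⁅y⁆⇒x≡y e e′∈))

  ∌-remove : ¬ removeAt p D ∋ p
  ∌-remove (mem p∈) = x∉p-x e (D ⟨ i , δ ⟩) (subst (e ∈_) (⟨⟩≔-updates D i δ _) p∈)

  ∋-remove⁺ : ∀ {q} → D ∋ q → q ≢ p → removeAt p D ∋ q
  ∋-remove⁺ {k , γ , e′} (mem q∈) q≢p .unmem with (k , γ) ≟ᴸ (i , δ)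
  ... | no  ≢    = subst (e′ ∈_) (sym (⟨⟩≔-minimal D _ ≢)) q∈
  ... | yes refl = subst (e′ ∈_) (sym (⟨⟩≔-updates D i δ _))
                     (x∈p∧x≢y⇒x∈p-y q∈ (λ e′≡e → q≢p (cong (λ x → i , δ , x) e′≡e)))

  ∋-remove⁻ : ∀ {q} → removeAt p D ∋ q → D ∋ q
  ∋-remove⁻ {k , γ , e′} (mem q∈) .unmem with (k , γ) ≟ᴸ (i , δ)
  ... | no  ≢    = subst (e′ ∈_) (⟨⟩≔-minimal D _ ≢) q∈
  ... | yes refl = p─q⊆p _ _ (subst (e′ ∈_) (⟨⟩≔-updates D i δ _) q∈)

-- A family is a finite Boolean table, so agreement at all positions forces equality. True equality
-- is wanted because `Change` is indexed by the resulting family: undoing must end in `D` itself.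
family-ext : {D E : Family n m} → (∀ {p} → D ∋ p → E ∋ p) → (∀ {p} → E ∋ p → D ∋ p) → D ≡ E
family-ext {D = D} {E} D⊆E E⊆D = begin
  D                    ≡⟨ tabulate∘lookup D ⟨
  tabulate (lookup D)  ≡⟨ tabulate-cong (λ i → cong₂ _,_ (same i false) (same i true)) ⟩
  tabulate (lookup E)  ≡⟨ tabulate∘lookup E ⟩
  E                    ∎
  where
  open ≡-Reasoning
  same : ∀ i δ → D ⟨ i , δ ⟩ ≡ E ⟨ i , δ ⟩
  same i δ = ⊆-antisym (λ e∈ → unmem (D⊆E {i , δ , _} (mem e∈)))
                       (λ e∈ → unmem (E⊆D {i , δ , _} (mem e∈)))

module _ (D : Family n m) (p : Position n m) where

  insert-∋ : D ∋ p → insertAt p D ≡ D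
  insert-∋ p∈ = family-ext
    (λ q∈ → [ id , (λ { refl → p∈ }) ]′ (∋-insert⁻ D p q∈))
    (∋-insert⁺ D p)

  insert-remove : D ∋ p → insertAt p (removeAt p D) ≡ D
  insert-remove p∈ = family-ext
    (λ q∈ → [ ∋-remove⁻ D p , (λ { refl → p∈ }) ]′ (∋-insert⁻ (removeAt p D) p q∈))
    back
    where
    back : ∀ {q} → D ∋ q → insertAt p (removeAt p D) ∋ q
    back {q} q∈ with q ≟ᴾ p
    ... | yes refl = ∋-insert (removeAt p D) p
    ... | no  q≢p  = ∋-insert⁺ (removeAt p D) p (∋-remove⁺ D p q∈ q≢p)

  remove-insert : ¬ D ∋ p → removeAt p (insertAt p D) ≡ D
  remove-insert p∉ = family-ext
    (λ q∈ → [ id , (λ { refl → contradiction q∈ (∌-remove (insertAt p D) p) }) ]′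
              (∋-insert⁻ D p (∋-remove⁻ (insertAt p D) p q∈)))
    (λ q∈ → ∋-remove⁺ (insertAt p D) p (∋-insert⁺ D p q∈) (λ { refl → p∉ q∈ }))

-- Conditions on a pair, read from an arbitrary superscript.

module _ (D : Family n m) {i : Fin n} {e : Fin m} where

  ∉-pair⁺ : ∀ δ → ¬ D ∋ (i , δ , e) → ¬ D ∋ (i , not δ , e) →
            e ∉ D ⟨ i , false ⟩ ∪ D ⟨ i , true ⟩
  ∉-pair⁺ false ∉δ ∉δ̄ e∈ = [ ∉δ ∘ mem , ∉δ̄ ∘ mem ]′ (x∈p∪q⁻ _ _ e∈)
  ∉-pair⁺ true  ∉δ ∉δ̄ e∈ = [ ∉δ̄ ∘ mem , ∉δ ∘ mem ]′ (x∈p∪q⁻ _ _ e∈)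

  ∉-pair⁻ : ∀ δ → e ∉ D ⟨ i , false ⟩ ∪ D ⟨ i , true ⟩ → ¬ D ∋ (i , δ , e)
  ∉-pair⁻ false e∉ (mem e∈) = e∉ (x∈p∪q⁺ (inj₁ e∈))
  ∉-pair⁻ true  e∉ (mem e∈) = e∉ (x∈p∪q⁺ (inj₂ e∈))

module _ {D : Family n m} (isSD : IsSpecialDecomposition D) where
  open IsSpecialDecomposition isSD

  disjointAt : ∀ {i e} δ → D ∋ (i , δ , e) → ¬ D ∋ (i , not δ , e)
  disjointAt false (mem ∈₀) (mem ∈₁) = disjoint _ (_ , x∈p∩q⁺ (∈₀ , ∈₁))
  disjointAt true  (mem ∈₁) (mem ∈₀) = disjoint _ (_ , x∈p∩q⁺ (∈₀ , ∈₁))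

  inhabitedAt : ∀ i δ → ∃[ e ] (D ∋ (i , δ , e) ⊎ D ∋ (i , not δ , e))
  inhabitedAt i false with inhabited i
  ... | inj₁ (e , e∈) = e , inj₁ (mem e∈)
  ... | inj₂ (e , e∈) = e , inj₂ (mem e∈)
  inhabitedAt i true with inhabited i
  ... | inj₁ (e , e∈) = e , inj₂ (mem e∈)
  ... | inj₂ (e , e∈) = e , inj₁ (mem e∈)

-- Single changes: preservation of the covering and reversal.

module _ {α : Assignment n} {D : Family n m} (cov : IsSpecialCovering α D) where

  coverAt : ∀ e → ∃[ i ] D ∋ (i , lookup α i , e)
  coverAt e = map₂ mem (cov e)

  -- Deletions touch only sets outside the covering, additions only enlarge sets, and a moved
  -- element stays covered by the set that receives it.
  change-covering : ∀ {D′} → Change α D D′ → IsSpecialCovering α D′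
  change-covering (delete {i} {δ} {e} _ δ∉ _) e′ with coverAt e′
  ... | k , e′∈ = k , unmem (∋-remove⁺ D (i , δ , e) e′∈ (λ { refl → δ∉ refl }))
  change-covering (add {i} {δ} {e} _) e′ with coverAt e′
  ... | k , e′∈ = k , unmem (∋-insert⁺ D (i , δ , e) e′∈)
  change-covering (move {j} {γ} {i} {δ} {e} _ refl _ _) e′ with coverAt e′
  ... | k , e′∈ with (k , lookup α k , e′) ≟ᴾ (j , γ , e)
  ...   | yes refl = i , unmem (∋-insert (remove j γ e D) (i , δ , e))
  ...   | no  ≢    = k , unmem (∋-insert⁺ (remove j γ e D) (i , δ , e) (∋-remove⁺ D (j , γ , e) e′∈ ≢))

  -- A deletion is undone by an addition; an addition by a deletion or by a move within the
  -- covering; a move by the reverse move or by an addition. The alternative `D′ ≡ D` records a move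
  -- of a position onto itself.
  undo : ∀ {D′} → IsSpecialDecomposition D → Change α D D′ → D′ ≡ D ⊎ Change α D′ D
  undo sd (delete {i} {δ} {e} e∈ _ _) =
    -- Disjointness in `D` keeps e out of the opposite set, so after the deletion e lies in neither
    -- set of the pair and can be added back.
    inj₂ (subst (Change α (removeAt p D)) (insert-remove D p (mem e∈))
      (add {δ = δ} (∉-pair⁺ (removeAt p D) δ (∌-remove D p) (disjointAt sd δ (mem e∈) ∘ ∋-remove⁻ D p))))
    where
    p = i , δ , e
  undo sd (add {i} {δ} {e} e∉) = inj₂ (by-cases (δ Bool.≟ lookup α i) (coverAt e))
    where
    p = i , δ , e
    D′ = insertAt p D
    p∉ : ¬ D ∋ p
    p∉ = ∉-pair⁻ D δ e∉
    -- The pair was inhabited before e was added. A witness in M_i^δ differs from e and survives the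
    -- deletion; one in the opposite set is untouched.
    rest : Nonempty ((D′ ⟨ i , δ ⟩ - e) ∪ D′ ⟨ i , not δ ⟩)
    rest with inhabitedAt sd i δ
    ... | e′ , inj₁ e′∈ = e′ , x∈p∪q⁺ (inj₁ (x∈p∧x≢y⇒x∈p-y (unmem (∋-insert⁺ D p e′∈))
                                               (λ { refl → p∉ e′∈ })))
    ... | e′ , inj₂ e′∈ = e′ , x∈p∪q⁺ (inj₂ (unmem (∋-insert⁺ D p e′∈)))
    -- This licenses a move of e into the covering set of index k. If the added position were the
    -- opposite one, then k = i and e would already have been in the pair.
    q̄∉ : ∀ {k} → D ∋ (k , lookup α k , e) → ¬ D′ ∋ (k , not (lookup α k) , e)
    q̄∉ q∈ q̄∈ with ∋-insert⁻ D p q̄∈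
    ... | inj₁ q̄∈D  = disjointAt sd _ q∈ q̄∈D
    ... | inj₂ refl = ∉-pair⁻ D _ e∉ q∈
    by-cases : _ → ∃[ k ] D ∋ (k , lookup α k , e) → Change α D′ D
    by-cases (no δ∉α) _ = subst (Change α D′) (remove-insert D p p∉)
      (delete (unmem (∋-insert D p)) δ∉α rest)
    -- An element of a covering set cannot be deleted, but it can be moved to a
    -- covering set that already contained it.
    by-cases (yes δ≡α) (k , q∈) =
      subst (Change α D′) (trans (cong (insertAt q) (remove-insert D p p∉)) (insert-∋ D q q∈))
        (move δ≡α refl (unmem (∋-insert D p)) (q̄∉ q∈ ∘ mem))
      where
      q = k , lookup α k , e
  undo sd (move {j} {i = i} {e = e} refl refl p∈ _) = by-cases (p ≟ᴾ q) (e ∈? D ⟨ i , lookup α i ⟩)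
    where
    p = j , lookup α j , e
    q = i , lookup α i , e
    D₀ = removeAt p D
    D′ = insertAt q D₀
    insert-p : insertAt p D₀ ≡ D
    insert-p = insert-remove D p (mem p∈)
    -- Needed both to add e back and to move it back. The inserted `q` cannot be the opposite of
    -- `p`: over the same variable, both `p` and `q` carry the superscript given by α.
    p̄∉ : ¬ D′ ∋ (j , not (lookup α j) , e)
    p̄∉ p̄∈ with ∋-insert⁻ D₀ q p̄∈
    ... | inj₁ p̄∈D₀ = disjointAt sd _ (mem p∈) (∋-remove⁻ D p p̄∈D₀)
    ... | inj₂ p̄≡q with cong proj₁ p̄≡q
    ...   | refl = not-¬ refl (sym (cong (proj₁ ∘ proj₂) p̄≡q))
    by-cases : Dec (p ≡ q) → _ → D′ ≡ D ⊎ Change α D′ D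
    by-cases (yes p≡q) _ = inj₁ (trans (cong (λ r → insertAt r D₀) (sym p≡q)) insert-p)
    -- The target already contained e, so the move merely erased `p`. A reverse move would also
    -- erase `q`; an addition restores `p` and keeps `q`.
    by-cases (no p≢q) (yes q∈) =
      inj₂ (subst (Change α D′) (trans (cong (insertAt p) D′≡D₀) insert-p)
        (add {δ = lookup α j} (∉-pair⁺ D′ (lookup α j) (∌-remove D p ∘ subst (_∋ p) D′≡D₀) p̄∉)))
      where
      D′≡D₀ : D′ ≡ D₀
      D′≡D₀ = insert-∋ D₀ q (∋-remove⁺ D p (mem q∈) (≢-sym p≢q))
    -- Here `q` is new, so moving e from `q` back to `p` cancels both halves of the change.
    by-cases (no p≢q) (no q∉) =
      inj₂ (subst (Change α D′)
        (trans (cong (insertAt p) (remove-insert D₀ q (q∉ ∘ unmem ∘ ∋-remove⁻ D p))) insert-p)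
        (move refl refl (unmem (∋-insert D₀ q)) (p̄∉ ∘ mem)))

-- Sequences of changes and their reversal.

generated-covering : {α : Assignment n} {D E : Family n m} →
                     IsSpecialCovering α D → GeneratedUnder α D E → IsSpecialCovering α E
generated-covering cov ε        = cov
generated-covering cov (x ◅ xs) =
  generated-covering (change-covering cov (AdmissibleChange.change x)) xs

-- Supplies the special decomposition from which each undoing step starts: a nonempty sequence
-- carries it in its first change, and an empty one has `D` equal to `E`.
generated-source : {α : Assignment n} {D E : Family n m} →
                   IsSpecialDecomposition E → GeneratedUnder α D E → IsSpecialDecomposition D
generated-source sdE ε       = sdE
generated-source sdE (x ◅ _) = AdmissibleChange.decomposition x

undoAdmissible : {α : Assignment n} {D D′ : Family n m} → IsSpecialDecomposition D′ →
                 AdmissibleChange α D D′ → GeneratedUnder α D′ D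
undoAdmissible sd′ x = [ (λ { refl → ε }) , (λ c → step c ◅ ε) ]′ (undo covering decomposition change)
  where
  open AdmissibleChange x
  step = λ c → record
    { decomposition = sd′
    ; covering      = change-covering covering change
    ; change        = c
    }

generated-sym : {α : Assignment n} {D E : Family n m} →
                IsSpecialDecomposition E → GeneratedUnder α D E → GeneratedUnder α E D
generated-sym sdE ε        = ε
generated-sym sdE (x ◅ xs) = generated-sym sdE xs ◅◅ undoAdmissible (generated-source sdE xs) x

-- Truth of literals and clauses.

evalLiteral-⇔ : (σ : Assignment n) (l : Literal n) → T (evalLiteral σ l) ⇔ proj₂ l ≡ lookup σ (proj₁ l)
evalLiteral-⇔ σ (j , true)  with lookup σ j
... | true  = mk⇔ (λ _ → refl) _
... | false = mk⇔ (λ ()) (λ ())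
evalLiteral-⇔ σ (j , false) with lookup σ j
... | true  = mk⇔ (λ ()) (λ ())
... | false = mk⇔ (λ _ → refl) _

-- The literals true under σ are exactly the x_i^{σ_i}, the ones that define the covering sets
-- F_i^{σ_i}.
evalClause-⇔ : (σ : Assignment n) (c : Clause n) →
               T (evalClause σ c) ⇔ (∃[ i ] (i , lookup σ i) List.∈ c)
evalClause-⇔ σ c = mk⇔
  (λ t → satisfying (List.find (any⁻ (evalLiteral σ) c t)))
  (λ (i , l∈) → any⁺ _ (List.lose l∈ (evalLiteral-⇔ σ (i , lookup σ i) .from refl)))
  where
  open Equivalence
  satisfying : ∃[ l ] (l List.∈ c × T (evalLiteral σ l)) → ∃[ i ] (i , lookup σ i) List.∈ c
  satisfying ((i , α) , l∈ , t) with evalLiteral-⇔ σ (i , α) .to t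
  ... | refl = i , l∈

-- The decomposition generated by a function.

module _ (f : CNF n m) where
  open DecMembership (_≟ᴸ_ {n}) using () renaming (_∈?_ to _∈ᴸ?_)
  open Equivalence

  decompositionOf-generates : FunctionGeneratedBy (decompositionOf f) f
  decompositionOf-generates e j α = mk⇔
    (λ l∈ → subst (e ∈_) (sym (row α)) (lookup⇒[]= e (occurrences f j α)
      (trans (lookup∘tabulate _ e) (dec-true ((j , α) ∈ᴸ? lookup (clauses f) e) l∈))))
    (λ e∈ → does-true⁻ ((j , α) ∈ᴸ? lookup (clauses f) e)
      (trans (sym (lookup∘tabulate _ e)) ([]=⇒lookup (subst (e ∈_) (row α) e∈))))
    where
    row : ∀ α → decompositionOf f ⟨ j , α ⟩ ≡ occurrences f j α
    row false = cong proj₁ (lookup∘tabulate _ j)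
    row true  = cong proj₂ (lookup∘tabulate _ j)

  -- The literals of the clauses decide every position of `D`. Hence the family hidden in `G σ f h`
  -- can only be the decomposition of `h`.
  decompositionOf-unique : ∀ {D} → FunctionGeneratedBy D f → D ≡ decompositionOf f
  decompositionOf-unique gen = family-ext
    (λ { {j , α , e} (mem e∈) → mem (decompositionOf-generates e j α .to (gen e j α .from e∈)) })
    (λ { {j , α , e} (mem e∈) → mem (gen e j α .to (decompositionOf-generates e j α .from e∈)) })

  -- The three conditions mirror the standing assumptions on a CNF: consistent clauses, occurrence
  -- of every variable, nonempty clauses.
  decompositionOf-special : IsSpecialDecomposition (decompositionOf f)
  decompositionOf-special = record
    { disjoint = λ i (e , e∈) → let ∈₀ , ∈₁ = x∈p∩q⁻ _ _ e∈ in
        consistent f e i (decompositionOf-generates e i false .from ∈₀ ,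
                          decompositionOf-generates e i true  .from ∈₁)
    ; inhabited = λ i → inhabited (occurs f i)
    ; covers = λ e → covers e (∃-literal (nonempty f e))
    }
    where
    inhabited : ∀ {i} → (∃₂ λ c α → (i , α) List.∈ lookup (clauses f) c) →
                Nonempty (decompositionOf f ⟨ i , false ⟩) ⊎ Nonempty (decompositionOf f ⟨ i , true ⟩)
    inhabited {i} (c , false , l∈) = inj₁ (c , decompositionOf-generates c i false .to l∈)
    inhabited {i} (c , true  , l∈) = inj₂ (c , decompositionOf-generates c i true  .to l∈)
    ∃-literal : ∀ {c : Clause n} → 1 ≤ length c → ∃[ l ] l List.∈ c
    ∃-literal {l ∷ _} _ = l , here refl
    covers : ∀ e → ∃[ l ] l List.∈ lookup (clauses f) e →
             ∃[ i ] e ∈ decompositionOf f ⟨ i , false ⟩ ∪ decompositionOf f ⟨ i , true ⟩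
    covers e ((i , false) , l∈) = i , x∈p∪q⁺ (inj₁ (decompositionOf-generates e i false .to l∈))
    covers e ((i , true)  , l∈) = i , x∈p∪q⁺ (inj₂ (decompositionOf-generates e i true  .to l∈))

  -- Both sides say that each clause contains some x_i^{σ_i}. This turns preservation of coverings
  -- into preservation of satisfaction by σ.
  covering⇔eval : ∀ σ → IsSpecialCovering σ (decompositionOf f) ⇔ eval f σ ≡ true
  covering⇔eval σ = mk⇔
    (λ cov → T-≡ .to (all⁻ (evalClause σ) (VecAll.toList⁺ (VecAll.lookup⁻ {xs = clauses f} (λ e →
      evalClause-⇔ σ (clause e) .from (map₂ (decompositionOf-generates e _ _ .from) (cov e)))))))
    (λ sat e → map₂ (decompositionOf-generates e _ _ .to) (evalClause-⇔ σ (clause e) .to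
      (VecAll.lookup⁺ (VecAll.toList⁻ {xs = clauses f} (all⁺ (evalClause σ) _ (T-≡ .from sat))) e)))
    where
    clause = lookup (clauses f)

-- The relation `G` as reachability between decompositions.

module _ {σ : Assignment n} where
  open Equivalence

  G⇔ : {f h : CNF n m} →
       G σ f h ⇔ (eval f σ ≡ true × GeneratedUnder σ (decompositionOf f) (decompositionOf h))
  G⇔ {f = f} {h} = mk⇔
    (λ g → let open G g in
      satisfied , subst (GeneratedUnder σ _) (decompositionOf-unique h generatesFunc) generated)
    (λ (sat , gen) → record
      { satisfied     = sat
      ; family        = decompositionOf h
      ; source        = decompositionOf-special f
      ; generated     = gen
      ; target        = decompositionOf-special h
      ; generatesFunc = decompositionOf-generates h
      })

  G-refl : {f : CNF n m} → eval f σ ≡ true → G σ f f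
  G-refl sat = G⇔ .from (sat , ε)

  G-sym : {f h : CNF n m} → G σ f h → G σ h f
  G-sym {f = f} {h} g with G⇔ .to g
  ... | sat , gen = G⇔ .from
    -- That σ satisfies `h` follows by carrying the covering of `f` along the changes.
    ( covering⇔eval h σ .to (generated-covering (covering⇔eval f σ .from sat) gen)
    , generated-sym (decompositionOf-special h) gen )

  G-trans : {f h k : CNF n m} → G σ f h → G σ h k → G σ f k
  G-trans g g′ with G⇔ .to g | G⇔ .to g′
  ... | sat , gen | _ , gen′ = G⇔ .from (sat , gen ◅◅ gen′)

theorem4p4 : (n m : ℕ) .{{_ : NonZero m}} (σ : Assignment n) →
    IsPartialEquivalence {A = SatisfiableCNF n m} (λ f h → G σ (proj₁ f) (proj₁ h)) ×
    IsEquivalence {A = CNFSatisfiedBy σ m} (λ f h → G σ (proj₁ f) (proj₁ h))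
theorem4p4 n m σ =
  record { sym = G-sym ; trans = G-trans } ,
  record { refl = λ {(_ , sat)} → G-refl sat ; sym = G-sym ; trans = G-trans }
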